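{- Let $n\ge 1$ and let $\sigma\in\mathfrak S_n$ be a permutation. Let $(\widehat P(\sigma),\widehat Q(\sigma))$ be the pair of standard Young-Fibonacci tableaux obtained by converting into tableaux the two saturated chains read on the right boundary ($\widehat P$) and on the upper boundary ($\widehat Q$) of Fomin's growth diagram of $\sigma$ for the Young-Fibonacci lattice, and let $(P(\sigma),Q(\sigma))$ be the Young-Fibonacci insertion and recording tableaux of $\sigma$. Then $\widehat P(\sigma)=P(\sigma)$ and $\widehat Q(\sigma)=Q(\sigma)$.
   Context: **Snakeshapes.** A snakeshape of size $n$ is a word $u=u_1u_2\cdots u_k$ with letters in $\{1,2\}$ and $u_1+\cdots+u_k=n$; it is drawn as $k$ bottom-justified columns, read from left to right, the $i$-th column having $u_i$ boxes. $\emptyset$ is the empty snakeshape. In a single-boxed column the unique box is both the bottom box and the top box of the column. **Young-Fibonacci lattice.** The snakeshapes are partially ordered by the following covering relations. A snakeshape $u$ is covered exactly by: (1) $1u$ (a single box attached in front); (2) the snakeshape obtained by adding a box on top of the first (leftmost) single-boxed column of $u$, if there is one; (3) if $u$ starts with a (maximal) series of two-boxed columns, every snakeshape obtained by inserting a single-boxed column just after one of the columns of this initial series. **Standard Young-Fibonacci tableaux.** A standard Young-Fibonacci tableau of size $n$ is a numbering of a snakeshape of size $n$ with $1,\dots,n$ (each used once) such that in each two-boxed column the top entry is larger than the bottom entry, and the entry in the top box of any column is larger than all entries in the columns to its right. **Insertion.** $P(\sigma)$ is built column by column from left to right by reading the word $\sigma=\sigma(1)\cdots\sigma(n)$ from right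 to left: each letter $a$ encountered that is not yet matched is compared with the largest not-yet-matched letter $b$ on its left, if any; if $b>a$, then $a$ and $b$ are matched and give the next column, with bottom entry $a$ and top entry $b$; otherwise $a$ gives the next column, single-boxed. $Q(\sigma)$ has the same shape as $P(\sigma)$: if a two-boxed column of $P(\sigma)$ has bottom entry $a$ and top entry $b$, the corresponding column of $Q(\sigma)$ has bottom entry $\sigma^{ -1}(b)$ and top entry $\sigma^{ -1}(a)$; a single-boxed column with entry $a$ corresponds to a single-boxed column with entry $\sigma^{ -1}(a)$. **Growth diagram.** Define snakeshapes $\Lambda(i,j)$, $0\le i,j\le n$, by $\Lambda(i,0)=\Lambda(0,j)=\emptyset$ and, for $i,j\ge1$, with $t=\Lambda(i-1,j-1)$, $x=\Lambda(i-1,j)$, $y=\Lambda(i,j-1)$, $z=\Lambda(i,j)$ and $\alpha=1$ if $\sigma(i)=j$, $\alpha=0$ otherwise, by the local rules: if $x\ne t$ and $y\neq t$ then $z=2t$ ($t$ with a two-boxed column added in front); if $x=y=t$ and $\alpha=1$ then $z=1t$; in all other cases $z=y$ if $x=t$, and $z=x$ if $y=t$. The chain on the upper boundary is $\widehat Q=(\Lambda(0,n),\Lambda(1,n),\dots,\Lambda(n,n))$ and the chain on the right boundary is $\widehat P=(\Lambda(n,0),\Lambda(n,1),\dots,\Lambda(n,n))$; both are saturated chains starting at $\emptyset$ in the Young-Fibonacci lattice. **Converting a saturated chain $(u^0=\emptyset,u^1,\dots,u^n)$ into a tableau.** Start with the empty tableau; given the tableau of shape $u^{m-1}$ with entries $1,\dots,m-1$,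 the tableau of shape $u^m$ is obtained as follows. (i) If the new box lies in the first column of $u^m$ (a new single-boxed column in front, or a box on top of a single-boxed first column), label it $m$. (ii) If the new box lies on top of the $j$-th column with $j\ge2$ (so columns $1,\dots,j-1$ are two-boxed), move the top entry of column $i$ to the top of column $i+1$ for all $1\le i\le j-1$, and put $m$ on top of the first column. (iii) If the new box is a new single-boxed column inserted just after the $j$-th column, $j\ge1$ (columns $1,\dots,j$ being two-boxed), move the top entry of column $j$ into the new box, move the top entry of column $i$ to the top of column $i+1$ for all $1\le i\le j-1$, and put $m$ on top of the first column. $\widehat P(\sigma)$ and $\widehat Q(\sigma)$ are the tableaux obtained in this way from the chains $\widehat P$ and $\widehat Q$. -}

module Defs where

open import Data.Bool.Base using (Bool; true; false; if_then_else_)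
open import Data.Empty using (⊥-elim)
open import Data.Fin.Base using (Fin; toℕ; fromℕ<)
open import Data.Fin.Permutation using (Permutation′; _⟨$⟩ʳ_; _⟨$⟩ˡ_; inverseˡ; inverseʳ)
open import Data.Fin.Properties as Fin
  using (any?; ≤-totalOrder; toℕ<n; toℕ-injective; toℕ-fromℕ<)
open import Data.List.Base using (List; []; _∷_; map; reverse; filter; allFin)
open import Data.List.Extrema using (max)
import Data.List.Membership.DecPropositional as DecMembership
open import Data.List.Properties using (≡-dec)
open import Data.List.Relation.Unary.All as All using (All; []; _∷_)
open import Data.Maybe.Base using (Maybe; just; nothing)
open import Data.Nat.Base using (ℕ; zero; suc; _+_; _∸_; _≤_; _<_; s≤s)
open import Data.Nat.Properties as ℕ using ()
open import Data.Product.Base using (∃; _×_; _,_)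
open import Data.Sum.Base using (_⊎_; inj₁; inj₂)
open import Function.Base using (_∘_; flip)
open import Relation.Binary.Definitions using (DecidableEquality)
open import Relation.Binary.PropositionalEquality
  using (_≡_; _≢_; refl; sym; trans; cong; subst; subst₂)
open import Relation.Nullary using (Dec; yes; no; does; ¬?)
open import Relation.Nullary.Decidable using (_×-dec_; dec-true; dec-false)

private
  variable
    A B : Set
    m n : ℕ

data Letter : Set where
  one two : Letter

Snakeshape : Set
Snakeshape = List Letter

_≟ᴸ_ : DecidableEquality Letter
one ≟ᴸ one = yes refl
one ≟ᴸ two = no λ ()
two ≟ᴸ one = no λ ()
two ≟ᴸ two = yes refl

_≟_ : DecidableEquality Snakeshape
_≟_ = ≡-dec _≟ᴸ_

size : Snakeshape → ℕ
size []        = 0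
size (one ∷ u) = 1 + size u
size (two ∷ u) = 2 + size u

private
  variable
    u v w t x y : Snakeshape

-- TopBox u v: v is u with a box put on top of its leftmost single-boxed
-- column.
data TopBox : Snakeshape → Snakeshape → Set where
  here  : TopBox (one ∷ w) (two ∷ w)
  there : TopBox u v → TopBox (two ∷ u) (two ∷ v)

-- Insertion u v: v is u with a single-boxed column inserted just after
-- one of the columns of the initial series of two-boxed columns of u.
data Insertion : Snakeshape → Snakeshape → Set where
  here  : Insertion (two ∷ w) (two ∷ one ∷ w)
  there : Insertion u v → Insertion (two ∷ u) (two ∷ v)

infix 4 _⋖_

data _⋖_ : Snakeshape → Snakeshape → Set where
  front  : u ⋖ one ∷ u
  top    : TopBox u v → u ⋖ v
  insert : Insertion u v → u ⋖ v

data Column (A : Set) : Letter → Set where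
  single : A → Column A one
  double : (bottom top : A) → Column A two

Numbering : Set → Snakeshape → Set
Numbering A = All (Column A)

Tableau : Set → Set
Tableau A = ∃ (Numbering A)

infixr 5 _◂_

_◂_ : ∀ {l} → Column A l → Tableau A → Tableau A
c ◂ (u , T) = (_ ∷ u) , (c ∷ T)

mapColumn : ∀ {l} → (A → B) → Column A l → Column B l
mapColumn f (single a)   = single (f a)
mapColumn f (double a b) = double (f a) (f b)

swapColumn : ∀ {l} → Column A l → Column A l
swapColumn (single a)   = single a
swapColumn (double a b) = double b a

mapTableau : (∀ {l} → Column A l → Column B l) → Tableau A → Tableau B
mapTableau f (u , T) = u , All.map f T

-- The element i of Fin n stands for the number i + 1 of {1,…,n}.
number : Fin n → ℕ
number i = suc (toℕ i)

module _ {n : ℕ} where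

  open DecMembership (Fin._≟_ {n}) using (_∈?_)

  largest : List (Fin n) → Maybe (Fin n)
  largest []       = nothing
  largest (a ∷ as) = just (max (≤-totalOrder n) a as)

  unmatched : (matched : List (Fin n)) → List (Fin n) → List (Fin n)
  unmatched matched = filter (λ b → ¬? (b ∈? matched))

  -- The second list is the part of the word still to be read, from right
  -- to left; `matched` collects the letters already used as top entries.
  columns : (matched : List (Fin n)) → List (Fin n) → Tableau (Fin n)
  columns matched []         = [] , []
  columns matched (a ∷ left) with a ∈? matched
  ... | yes _ = columns matched left
  ... | no  _ with largest (unmatched matched left)
  ...   | nothing = single a ◂ columns matched left
  ...   | just b with a Fin.<? b
  ...     | yes _ = double a b ◂ columns (b ∷ matched) left
  ...     | no  _ = single a ◂ columns matched left

  insertionTableau : Permutation′ n → Tableau (Fin n)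
  insertionTableau σ = columns [] (reverse (map (σ ⟨$⟩ʳ_) (allFin n)))

  P : Permutation′ n → Tableau ℕ
  P σ = mapTableau (mapColumn number) (insertionTableau σ)

  Q : Permutation′ n → Tableau ℕ
  Q σ = mapTableau (mapColumn (λ a → number (σ ⟨$⟩ˡ a)) ∘ swapColumn)
                   (insertionTableau σ)

-- local t x y α is the corner z opposite to t.
local : (t x y : Snakeshape) → Bool → Snakeshape
local t x y α with x ≟ t | y ≟ t
... | no  _ | no  _ = two ∷ t
... | yes _ | yes _ = if α then one ∷ t else y
... | yes _ | no  _ = y
... | no  _ | yes _ = x

grid : (ℕ → ℕ → Bool) → ℕ → ℕ → Snakeshape
grid α zero    _       = []
grid α (suc i) zero    = []
grid α (suc i) (suc j) =
  local (grid α i j) (grid α i (suc j)) (grid α (suc i) j) (α (suc i) (suc j))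

-- The indices i and j are 1-based; indices outside {1,…,n} are unmarked.
marked? : (σ : Permutation′ n) (i j : ℕ) →
          Dec (∃ λ k → number k ≡ i × number (σ ⟨$⟩ʳ k) ≡ j)
marked? σ i j = any? λ k → (number k ℕ.≟ i) ×-dec (number (σ ⟨$⟩ʳ k) ℕ.≟ j)

mark : Permutation′ n → ℕ → ℕ → Bool
mark σ i j = does (marked? σ i j)

-- Only the values with i , j ≤ n are meaningful.
Λ : Permutation′ n → ℕ → ℕ → Snakeshape
Λ σ = grid (mark σ)

-- u 0 , … , u m is a saturated chain starting at ∅.
data Saturated (u : ℕ → Snakeshape) : ℕ → Set where
  start : u 0 ≡ [] → Saturated u 0
  _▷_   : Saturated u m → u m ⋖ u (suc m) → Saturated u (suc m)

-- In shiftTop and shiftInsert, m goes on top of the first column, the top entry it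
-- displaces goes on top of the next column, and so on, until the new box
-- receives the last displaced entry (or m itself, if it is on top of the
-- first column).
shiftTop : A → TopBox u v → Numbering A u → Numbering A v
shiftTop m here      (single a ∷ T)   = double a m ∷ T
shiftTop m (there p) (double a b ∷ T) = double a m ∷ shiftTop b p T

shiftInsert : A → Insertion u v → Numbering A u → Numbering A v
shiftInsert m here      (double a b ∷ T) = double a m ∷ single b ∷ T
shiftInsert m (there p) (double a b ∷ T) = double a m ∷ shiftInsert b p T

extend : A → u ⋖ v → Numbering A u → Numbering A v
extend m front      T = single m ∷ T
extend m (top p)    T = shiftTop m p T
extend m (insert p) T = shiftInsert m p T

convert : {u : ℕ → Snakeshape} → Saturated u m → Numbering ℕ (u m)
convert (start u₀≡[])   = subst (Numbering ℕ) (sym u₀≡[]) []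
convert (_▷_ {m = m} c p) = extend (suc m) p (convert c)

size-TopBox : TopBox u v → size v ≡ suc (size u)
size-TopBox here      = refl
size-TopBox (there p) = cong (2 +_) (size-TopBox p)

size-Insertion : Insertion u v → size v ≡ suc (size u)
size-Insertion here      = refl
size-Insertion (there p) = cong (2 +_) (size-Insertion p)

size-⋖ : u ⋖ v → size v ≡ suc (size u)
size-⋖ front      = refl
size-⋖ (top p)    = size-TopBox p
size-⋖ (insert p) = size-Insertion p

⋖⇒≢ : u ⋖ v → u ≢ v
⋖⇒≢ p refl = ℕ.1+n≢n (sym (size-⋖ p))

TopBox⇒Insertion : TopBox u v → Insertion v (two ∷ u)
TopBox⇒Insertion here      = here
TopBox⇒Insertion (there p) = there (TopBox⇒Insertion p)

Insertion⇒TopBox : Insertion u v → TopBox v (two ∷ u)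
Insertion⇒TopBox here      = there here
Insertion⇒TopBox (there p) = there (Insertion⇒TopBox p)

⋖-two : u ⋖ v → v ⋖ two ∷ u
⋖-two front      = top here
⋖-two (top p)    = insert (TopBox⇒Insertion p)
⋖-two (insert p) = top (Insertion⇒TopBox p)

_⋖⁼_ : Snakeshape → Snakeshape → Set
u ⋖⁼ v = u ≡ v ⊎ u ⋖ v

strict : u ⋖⁼ v → u ≢ v → u ⋖ v
strict (inj₁ u≡v) u≢v = ⊥-elim (u≢v u≡v)
strict (inj₂ u⋖v) _   = u⋖v

local-sym : ∀ t x y α → local t x y α ≡ local t y x α
local-sym t x y α with x ≟ t | y ≟ t
... | no  _    | no  _    = refl
... | yes refl | yes refl = refl
... | yes _    | no  _    = refl
... | no  _    | yes _    = refl

local-⋖⁼ : ∀ t x y α → t ⋖⁼ x → t ⋖⁼ y → y ⋖⁼ local t x y α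
local-⋖⁼ t x y α p q with x ≟ t | y ≟ t
... | no  _   | no y≢t   = inj₂ (⋖-two (strict q (y≢t ∘ sym)))
local-⋖⁼ t x y true  p q | yes _ | yes refl = inj₂ front
local-⋖⁼ t x y false p q | yes _ | yes refl = inj₁ refl
... | yes _   | no _     = inj₁ refl
... | no  _   | yes refl = p

local-strict : ∀ t x y α → t ⋖⁼ y → t ≢ x → y ≢ local t x y α
local-strict t x y α q t≢x with x ≟ t | y ≟ t
... | no _    | no y≢t   = ⋖⇒≢ (⋖-two (strict q (y≢t ∘ sym)))
... | no _    | yes refl = t≢x
... | yes x≡t | _        = ⊥-elim (t≢x (sym x≡t))

local-marked : ∀ t x y → t ⋖⁼ y → y ≡ t → y ≢ local t x y true
local-marked t x y q y≡t with x ≟ t | y ≟ t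
... | _       | no y≢t   = ⊥-elim (y≢t y≡t)
... | yes _   | yes refl = ⋖⇒≢ front
... | no  x≢t | yes refl = x≢t ∘ sym

local-unmarked : ∀ t x y → y ≡ t → x ≡ local t x y false
local-unmarked t x y y≡t with x ≟ t | y ≟ t
... | _       | no y≢t   = ⊥-elim (y≢t y≡t)
... | yes x≡t | yes y≡t′ = trans x≡t (sym y≡t′)
... | no  _   | yes _    = refl

grid-zero : ∀ α i → grid α i 0 ≡ []
grid-zero α zero    = refl
grid-zero α (suc i) = refl

grid-flip : ∀ α i j → grid (flip α) j i ≡ grid α i j
grid-flip α zero    j       = grid-zero _ j
grid-flip α (suc i) zero    = refl
grid-flip α (suc i) (suc j)
  rewrite grid-flip α i j | grid-flip α i (suc j) | grid-flip α (suc i) j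
  = local-sym (grid α i j) (grid α (suc i) j) (grid α i (suc j)) (α (suc i) (suc j))

mutual
  vertical : ∀ α i j → grid α i j ⋖⁼ grid α i (suc j)
  vertical α zero    j = inj₁ refl
  vertical α (suc i) j = local-⋖⁼ _ _ _ _ (vertical α i j) (horizontal α i j)

  horizontal : ∀ α i j → grid α i j ⋖⁼ grid α (suc i) j
  horizontal α i zero    = inj₁ (grid-zero α i)
  horizontal α i (suc j) = subst (grid α i (suc j) ⋖⁼_)
    (local-sym (grid α i j) (grid α (suc i) j) (grid α i (suc j)) (α (suc i) (suc j)))
    (local-⋖⁼ _ _ _ _ (horizontal α i j) (vertical α i j))

row-constant : ∀ α i j → (∀ k → k ≤ j → α (suc i) k ≡ false) →
               grid α i j ≡ grid α (suc i) j
row-constant α i zero    _ = grid-zero α i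
row-constant α i (suc j) h rewrite h (suc j) ℕ.≤-refl =
  local-unmarked (grid α i j) (grid α i (suc j)) (grid α (suc i) j)
    (sym (row-constant α i j (λ k k≤j → h k (ℕ.m≤n⇒m≤1+n k≤j))))

vertical-strict : ∀ α i j d →
  α (suc i) (suc j) ≡ true → (∀ k → k ≤ j → α (suc i) k ≡ false) →
  grid α (d + suc i) j ≢ grid α (d + suc i) (suc j)
vertical-strict α i j zero    e h rewrite e =
  local-marked (grid α i j) (grid α i (suc j)) (grid α (suc i) j)
    (horizontal α i j) (sym (row-constant α i j h))
vertical-strict α i j (suc d) e h =
  local-strict _ _ _ (α (suc (d + suc i)) (suc j))
    (horizontal α (d + suc i) j) (vertical-strict α i j d e h)

saturated : (α : ℕ → ℕ → Bool) (n : ℕ) →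
  (∀ j → j < n → ∃ λ i → i < n × α (suc i) (suc j) ≡ true
                        × (∀ k → k ≤ j → α (suc i) k ≡ false)) →
  ∀ m → m ≤ n → Saturated (grid α n) m
saturated α n h zero    _   = start (grid-zero α n)
saturated α n h (suc j) j<n with h j j<n
... | i , i<n , e , f = saturated α n h j (ℕ.<⇒≤ j<n) ▷
  strict (vertical α n j)
    (subst (λ k → grid α k j ≢ grid α k (suc j)) (ℕ.m∸n+n≡m i<n)
      (vertical-strict α i j (n ∸ suc i) e f))

Saturated-cong : ∀ {u v : ℕ → Snakeshape} → (∀ i → u i ≡ v i) →
                 Saturated u m → Saturated v m
Saturated-cong h (start e) = start (trans (sym (h 0)) e)
Saturated-cong h (c ▷ p)   = Saturated-cong h c ▷ subst₂ _⋖_ (h _) (h _) p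

mark-true : (σ : Permutation′ n) (k : Fin n) →
            mark σ (number k) (number (σ ⟨$⟩ʳ k)) ≡ true
mark-true σ k = dec-true (marked? σ _ _) (k , refl , refl)

number-injective : {a b : Fin n} → number a ≡ number b → a ≡ b
number-injective = toℕ-injective ∘ ℕ.suc-injective

mark-false-row : (σ : Permutation′ n) (k : Fin n) (j : ℕ) →
                 j ≢ number (σ ⟨$⟩ʳ k) → mark σ (number k) j ≡ false
mark-false-row σ k j j≢ = dec-false (marked? σ _ _) λ where
  (l , l≡k , σl≡j) → j≢ (trans (sym σl≡j) (cong (number ∘ (σ ⟨$⟩ʳ_)) (number-injective l≡k)))

mark-false-column : (σ : Permutation′ n) (k : Fin n) (i : ℕ) →
                    i ≢ number k → mark σ i (number (σ ⟨$⟩ʳ k)) ≡ false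
mark-false-column σ k i i≢ = dec-false (marked? σ _ _) λ where
  (l , l≡i , σl≡σk) → i≢ (trans (sym l≡i) (cong number
    (trans (sym (inverseˡ σ)) (trans (cong (σ ⟨$⟩ˡ_) (number-injective σl≡σk)) (inverseˡ σ)))))

rightChain : (σ : Permutation′ n) → Saturated (λ j → Λ σ n j) n
rightChain {n} σ = saturated (mark σ) n marks n ℕ.≤-refl
  where
  marks : ∀ j → j < n → ∃ λ i → i < n × mark σ (suc i) (suc j) ≡ true
                              × (∀ k → k ≤ j → mark σ (suc i) k ≡ false)
  marks j j<n = toℕ k , toℕ<n k
    , subst (λ l → mark σ (number k) l ≡ true) σk≡j (mark-true σ k)
    , λ l l≤j → mark-false-row σ k l λ l≡ → ℕ.<⇒≢ (s≤s l≤j) (trans l≡ σk≡j)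
    where
    k = σ ⟨$⟩ˡ fromℕ< j<n
    σk≡j : number (σ ⟨$⟩ʳ k) ≡ suc j
    σk≡j = cong suc (trans (cong toℕ (inverseʳ σ)) (toℕ-fromℕ< j<n))

upperChain : (σ : Permutation′ n) → Saturated (λ i → Λ σ i n) n
upperChain {n} σ = Saturated-cong (λ i → grid-flip (mark σ) i n)
                     (saturated (flip (mark σ)) n marks n ℕ.≤-refl)
  where
  marks : ∀ i → i < n → ∃ λ j → j < n × mark σ (suc i) (suc j) ≡ true
                              × (∀ k → k ≤ i → mark σ k (suc j) ≡ false)
  marks i i<n = toℕ (σ ⟨$⟩ʳ k) , toℕ<n (σ ⟨$⟩ʳ k)
    , subst (λ l → mark σ l (number (σ ⟨$⟩ʳ k)) ≡ true) k≡i (mark-true σ k)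
    , λ l l≤i → mark-false-column σ k l λ l≡ → ℕ.<⇒≢ (s≤s l≤i) (trans l≡ k≡i)
    where
    k = fromℕ< i<n
    k≡i : number k ≡ suc i
    k≡i = cong suc (toℕ-fromℕ< i<n)

P̂ : Permutation′ n → Tableau ℕ
P̂ {n} σ = Λ σ n n , convert (rightChain σ)

Q̂ : Permutation′ n → Tableau ℕ
Q̂ {n} σ = Λ σ n n , convert (upperChain σ)

{-# OPTIONS --safe #-}

-- Regard σ as the set of points (row, column) = (i , σ(i)). Its insertion
-- tableau is built from the point p of maximal row and the point q of
-- maximal column: if p = q, the first column is single-boxed, otherwise
-- it has p below q, and one continues without these points.  This description
-- is symmetric up to exchanging bottom and top entries, which reduces Q to P.
-- The local rules of the growth diagram express the same recursion for the
-- points of a rectangle, so Λ(i,j) is the shape attached to [1,i] × [1,j].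
-- Adding a point of new maximal column displaces the former q, which is
-- then added to the remaining points as a point of maximal column: this
-- is the cascade of top entries in the conversion of a chain.
module Submission where

open import Defs
open import Data.Bool.Base using (Bool; true; false)
open import Data.Fin.Base as Fin using (Fin; toℕ; fromℕ<)
open import Data.Fin.Permutation as Permutation
  using (Permutation′; _⟨$⟩ʳ_; _⟨$⟩ˡ_; inverseˡ; inverseʳ)
open import Data.Fin.Properties as Fin using (any?; ≤-totalOrder; toℕ-fromℕ<; toℕ<n)
open import Data.List.Base using (List; []; _∷_; allFin; filter; length; map; reverse)
open import Data.List.Extrema using (max; argmax-sel; ⊥≤max; xs≤max)
import Data.List.Membership.DecPropositional as DecMembership
open import Data.List.Membership.Propositional using (_∈_)
open import Data.List.Membership.Propositional.Properties
  using (∈-allFin; ∈-map⁺; ∈-filter⁺; ∈-filter⁻)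
open import Data.List.Membership.Propositional.Properties.WithK using (unique∧set⇒bag)
open import Data.List.Properties using (filter-all; filter-none; unfold-reverse)
open import Data.List.Relation.Binary.BagAndSetEquality using (∼bag⇒↭)
open import Data.List.Relation.Binary.Permutation.Propositional
  using (_↭_; ↭-refl; ↭-reflexive; ↭-sym; ↭-trans; prep; swap)
open import Data.List.Relation.Binary.Permutation.Propositional.Properties
  using (All-resp-↭; drop-∷; ∈-resp-↭; ¬x∷xs↭[]; ↭-length; ↭-reverse)
open import Data.List.Relation.Unary.All as All using (All; []; _∷_)
open import Data.List.Relation.Unary.All.Properties as All using ()
open import Data.List.Relation.Unary.AllPairs as AllPairs using (AllPairs; []; _∷_)
import Data.List.Relation.Unary.AllPairs.Properties as AllPairs
open import Data.List.Relation.Unary.Any using (here; there)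
open import Data.List.Relation.Unary.Unique.Propositional using (Unique)
import Data.List.Relation.Unary.Unique.Propositional.Properties as Unique
open import Data.Maybe.Base using (just; nothing)
open import Data.Nat.Base using (ℕ; zero; suc; _≤_; _<_; s≤s)
open import Data.Nat.Properties as ℕ using (<-cmp; <-irrefl; <-asym; <-trans)
open import Data.Product.Base as Product using (∃; _×_; _,_; proj₁; proj₂)
open import Data.Sum.Base using (inj₁; inj₂)
open import Function.Base using (_∘_; flip; id)
open import Function.Bundles using (mk⇔)
open import Relation.Binary.Definitions using (tri<; tri≈; tri>)
open import Relation.Binary.PropositionalEquality
  using (_≡_; _≢_; refl; sym; trans; cong; subst; subst₂)
open import Relation.Nullary using (Dec; ¬_; yes; no; contradiction; ¬?; proof)
open import Relation.Nullary.Decidable using (_×-dec_; map′)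
open import Relation.Nullary.Reflects using (Reflects; ofʸ; ofⁿ)

private
  variable
    A B : Set
    m n i j : ℕ
    t u v x y : Snakeshape
    a b p q : A
    X Y : List A
    T T′ : Tableau A

-- Inequalities between natural numbers

≤∧≡suc⇒< : ∀ {k l} → k ≤ m → l ≡ suc m → k < l
≤∧≡suc⇒< k≤m refl = s≤s k≤m

≤suc∧≢⇒≤ : m ≤ suc n → m ≢ suc n → m ≤ n
≤suc∧≢⇒≤ m≤ m≢ = ℕ.<⇒≤pred (ℕ.≤∧≢⇒< m≤ m≢)

-- Saturated chains

TopBox-irrelevant : (s s′ : TopBox u v) → s ≡ s′
TopBox-irrelevant here      here       = refl
TopBox-irrelevant (there s) (there s′) = cong there (TopBox-irrelevant s s′)

Insertion-irrelevant : (s s′ : Insertion u v) → s ≡ s′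
Insertion-irrelevant here      here       = refl
Insertion-irrelevant (there s) (there s′) = cong there (Insertion-irrelevant s s′)

-- One operation keeps the number of columns, the other adds a column.
¬TopBox∧Insertion : TopBox u v → ¬ Insertion u v
¬TopBox∧Insertion (there s) (there s′) = ¬TopBox∧Insertion s s′

-- The coverings in a chain come from the growth diagram, those in `Step` from adding points;
-- irrelevance allows them to be identified. A `front` covering ends in a shape beginning with
-- `one`, all others in a shape beginning with `two`.
⋖-irrelevant : (s s′ : u ⋖ v) → s ≡ s′
⋖-irrelevant front      front       = refl
⋖-irrelevant (top s)    (top s′)    = cong top (TopBox-irrelevant s s′)
⋖-irrelevant (top s)    (insert s′) = contradiction s′ (¬TopBox∧Insertion s)
⋖-irrelevant (insert s) (top s′)    = contradiction s (¬TopBox∧Insertion s′)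
⋖-irrelevant (insert s) (insert s′) = cong insert (Insertion-irrelevant s s′)

module _ (f : A → B) where

  map-shiftTop : ∀ m (s : TopBox u v) N →
    All.map (mapColumn f) (shiftTop m s N) ≡ shiftTop (f m) s (All.map (mapColumn f) N)
  map-shiftTop m here      (single a ∷ N)   = refl
  map-shiftTop m (there s) (double a b ∷ N) = cong (_ ∷_) (map-shiftTop b s N)

  map-shiftInsert : ∀ m (s : Insertion u v) N →
    All.map (mapColumn f) (shiftInsert m s N) ≡ shiftInsert (f m) s (All.map (mapColumn f) N)
  map-shiftInsert m here      (double a b ∷ N) = refl
  map-shiftInsert m (there s) (double a b ∷ N) = cong (_ ∷_) (map-shiftInsert b s N)

  map-extend : ∀ m (s : u ⋖ v) N →
    All.map (mapColumn f) (extend m s N) ≡ extend (f m) s (All.map (mapColumn f) N)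
  map-extend m front      N = refl
  map-extend m (top s)    N = map-shiftTop m s N
  map-extend m (insert s) N = map-shiftInsert m s N

data Step (m : A) : Tableau A → Tableau A → Set where
  step : (s : u ⋖ v) (N : Numbering A u) → Step m (u , N) (v , extend m s N)

-- The entry `b` displaces `q`, which becomes the incoming entry of the remaining columns. A new
-- column in front of these is an insertion just after the first column; any other covering moves
-- one column deeper.
Step-double : Step q T T′ → Step b (double p q ◂ T) (double p b ◂ T′)
Step-double (step front      N) = step (insert here) (double _ _ ∷ N)
Step-double (step (top s)    N) = step (top (there s)) (double _ _ ∷ N)
Step-double (step (insert s) N) = step (insert (there s)) (double _ _ ∷ N)

-- As coverings are irrelevant, equality of the final shapes is enough to replace the covering
-- hidden in the `Step` by `s`.
Step⇒extend : (f : A → ℕ) → Step a T T′ → (s : u ⋖ v) {N : Numbering ℕ u} →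
  (u , N) ≡ mapTableau (mapColumn f) T → v ≡ proj₁ T′ →
  (v , extend (f a) s N) ≡ mapTableau (mapColumn f) T′
Step⇒extend f (step s′ N) s refl refl = cong (_ ,_)
  (trans (cong (λ s → extend _ s _) (⋖-irrelevant s s′)) (sym (map-extend f _ s′ N)))

-- Insertion tableaux of point sets

private
  variable
    r c : A → ℕ

-- Lists stand for finite sets of points, hence `↭`. In `matched` each bound includes the other
-- extremal point, which forces `p` and `q` to be distinct.
data IsInsertion {A : Set} (r c : A → ℕ) : List A → Tableau A → Set where
  []      : IsInsertion r c [] ([] , [])
  fixed   : X ↭ p ∷ Y →
            All (λ y → r y < r p) Y → All (λ y → c y < c p) Y →
            IsInsertion r c Y T → IsInsertion r c X (single p ◂ T)
  matched : X ↭ p ∷ q ∷ Y →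
            All (λ y → r y < r p) (q ∷ Y) → All (λ y → c y < c q) (p ∷ Y) →
            IsInsertion r c Y T → IsInsertion r c X (double p q ◂ T)

IsInsertion-resp-↭ : X ↭ Y → IsInsertion r c X T → IsInsertion r c Y T
IsInsertion-resp-↭ {Y = []}    X↭Y [] = []
IsInsertion-resp-↭ {Y = _ ∷ _} X↭Y [] = contradiction (↭-sym X↭Y) ¬x∷xs↭[]
IsInsertion-resp-↭ X↭Y (fixed e R C I)   = fixed (↭-trans (↭-sym X↭Y) e) R C I
IsInsertion-resp-↭ X↭Y (matched e R C I) = matched (↭-trans (↭-sym X↭Y) e) R C I

IsInsertion-size : IsInsertion r c X T → size (proj₁ T) ≡ length X
IsInsertion-size []                = refl
IsInsertion-size (fixed e _ _ I)   = trans (cong suc (IsInsertion-size I)) (sym (↭-length e))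
IsInsertion-size (matched e _ _ I) =
  trans (cong (suc ∘ suc) (IsInsertion-size I)) (sym (↭-length e))

↭-swap₂ : p ∷ q ∷ X ↭ q ∷ p ∷ X
↭-swap₂ = swap _ _ ↭-refl

IsInsertion-transpose : IsInsertion r c X T → IsInsertion c r X (mapTableau swapColumn T)
IsInsertion-transpose []              = []
IsInsertion-transpose (fixed e R C I) = fixed e C R (IsInsertion-transpose I)
IsInsertion-transpose (matched e R C I) =
  matched (↭-trans e ↭-swap₂) C R (IsInsertion-transpose I)

maximum-unique : (f : A → ℕ) → p ∷ X ↭ q ∷ Y →
  All (λ y → f y < f p) X → All (λ y → f y < f q) Y → p ≡ q
maximum-unique f e maxp maxq with ∈-resp-↭ e (here refl) | ∈-resp-↭ (↭-sym e) (here refl)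
... | here p≡q  | _         = p≡q
... | there _   | here q≡p  = sym q≡p
... | there p∈Y | there q∈X =
  contradiction (All.lookup maxp q∈X) (<-asym (All.lookup maxq p∈Y))

-- The maximal row determines `p`, the maximal column determines `q`, and cancelling them leaves
-- permuted remainders. If `fixed` meets `matched`, both maxima are the same point, whose row would
-- be smaller than itself.
IsInsertion-unique : X ↭ Y → IsInsertion r c X T → IsInsertion r c Y T′ → T ≡ T′
IsInsertion-unique e [] [] = refl
IsInsertion-unique e [] (fixed e′ _ _ _) = contradiction (↭-sym (↭-trans e e′)) ¬x∷xs↭[]
IsInsertion-unique e [] (matched e′ _ _ _) = contradiction (↭-sym (↭-trans e e′)) ¬x∷xs↭[]
IsInsertion-unique e (fixed e′ _ _ _) [] = contradiction (↭-trans (↭-sym e′) e) ¬x∷xs↭[]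
IsInsertion-unique e (matched e′ _ _ _) [] = contradiction (↭-trans (↭-sym e′) e) ¬x∷xs↭[]
IsInsertion-unique {r = r} e (fixed e₁ R C I) (fixed e₂ R′ C′ I′)
  with e′ ← ↭-trans (↭-sym e₁) (↭-trans e e₂)
  with refl ← maximum-unique r e′ R R′
  = cong (single _ ◂_) (IsInsertion-unique (drop-∷ e′) I I′)
IsInsertion-unique {r = r} {c = c} e (matched e₁ R C I) (matched e₂ R′ C′ I′)
  with e′ ← ↭-trans (↭-sym e₁) (↭-trans e e₂)
  with refl ← maximum-unique r e′ R R′
  with refl ← maximum-unique c (↭-trans ↭-swap₂ (↭-trans e′ ↭-swap₂)) C C′
  = cong (double _ _ ◂_) (IsInsertion-unique (drop-∷ (drop-∷ e′)) I I′)
IsInsertion-unique {r = r} {c = c} e (fixed e₁ R C I) (matched e₂ R′ C′ I′)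
  with e′ ← ↭-trans (↭-sym e₁) (↭-trans e e₂)
  with refl ← maximum-unique r e′ R R′
  with refl ← maximum-unique c (↭-trans e′ ↭-swap₂) C C′
  = contradiction (All.head R′) (<-irrefl refl)
IsInsertion-unique {r = r} {c = c} e (matched e₁ R C I) (fixed e₂ R′ C′ I′)
  with e′ ← ↭-trans (↭-sym e₁) (↭-trans e e₂)
  with refl ← maximum-unique r e′ R R′
  with refl ← maximum-unique c (↭-trans ↭-swap₂ e′) C C′
  = contradiction (All.head R) (<-irrefl refl)

Injective : (A → ℕ) → Set
Injective f = ∀ {a b} → f a ≡ f b → a ≡ b

insert-corner : X ↭ p ∷ Y → All (λ y → r y < r p) Y → r p < r a →
  All (λ y → c y < c a) X → IsInsertion r c X T → IsInsertion r c (a ∷ X) (single a ◂ T)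
insert-corner e R rp<ra C =
  fixed ↭-refl (All-resp-↭ (↭-sym e) (rp<ra ∷ All.map (λ ry → <-trans ry rp<ra) R)) C

-- The row of `a` is compared with the maximal row, that of `p`. If it is larger, `a` is maximal in
-- both directions and gives a single-boxed column in front; otherwise `p` is the bottom entry of
-- the first column and `a` goes on top of it.
insert-maximum : Injective r → All (λ y → c y < c a) X → IsInsertion r c X T →
  ∃ λ T′ → IsInsertion r c (a ∷ X) T′ × Step a T T′
insert-maximum inj C [] = _ , fixed ↭-refl [] [] [] , step front []
insert-maximum {r = r} {a = a} inj C I@(fixed {p = p} {T = _ , N} e R _ I₀)
  with C₀ ← All-resp-↭ e C
  with <-cmp (r a) (r p)
... | tri< ra<rp _ _ =
  _ , matched (↭-trans (prep a e) ↭-swap₂) (ra<rp ∷ R) C₀ I₀ , step (top here) (single p ∷ N)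
... | tri≈ _ ra≡rp _ with refl ← inj ra≡rp = contradiction (All.head C₀) (<-irrefl refl)
... | tri> _ _ rp<ra = _ , insert-corner e R rp<ra C I , step front _
insert-maximum {r = r} {a = a} inj C I@(matched {p = p} e R (_ ∷ C₁) I₀)
  with C₀ ← All-resp-↭ e C
  with <-cmp (r a) (r p)
-- By `C₁` the displaced `q` has a larger column than all of `Y`, so the recursive call can add it
-- to the remaining points.
... | tri< ra<rp _ _ with _ , I₁ , s ← insert-maximum inj C₁ I₀ =
  _ , matched (↭-trans (prep a e) ↭-swap₂) (ra<rp ∷ R) C₀ I₁ , Step-double s
... | tri≈ _ ra≡rp _ with refl ← inj ra≡rp = contradiction (All.head C₀) (<-irrefl refl)
... | tri> _ _ rp<ra = _ , insert-corner e R rp<ra C I , step front _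

Unique∧set⇒↭ : Unique X → Unique Y →
  (∀ {z} → z ∈ X → z ∈ Y) → (∀ {z} → z ∈ Y → z ∈ X) → X ↭ Y
Unique∧set⇒↭ X! Y! X⊆Y Y⊆X = ∼bag⇒↭ (unique∧set⇒bag X! Y! (mk⇔ X⊆Y Y⊆X))

-- Reading the word of a permutation

module _ {n : ℕ} where

  open DecMembership (Fin._≟_ {n}) using (_∈?_)

  largest-nothing : ∀ {xs : List (Fin n)} → largest xs ≡ nothing → xs ≡ []
  largest-nothing {[]} _ = refl

  largest-just : ∀ {b} {xs : List (Fin n)} → largest xs ≡ just b →
    b ∈ xs × (∀ {z} → z ∈ xs → z Fin.≤ b)
  largest-just {xs = a ∷ as} refl = max∈ , λ where
      (here refl) → ⊥≤max (≤-totalOrder n) a as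
      (there z∈)  → All.lookup (xs≤max (≤-totalOrder n) a as) z∈
    where
    max∈ : max (≤-totalOrder n) a as ∈ a ∷ as
    max∈ with argmax-sel (≤-totalOrder n) id a as
    ... | inj₁ b≡a = here b≡a
    ... | inj₂ b∈  = there b∈

  ∉? : ∀ (ms : List (Fin n)) z → Dec (¬ z ∈ ms)
  ∉? ms z = ¬? (z ∈? ms)

  unmatched-≢ : ∀ {b z : Fin n} {ms} xs → z ∈ unmatched (b ∷ ms) xs → b ≢ z
  unmatched-≢ xs z∈ refl = proj₂ (∈-filter⁻ (∉? _) {xs = xs} z∈) (here refl)

  -- Recording a letter as matched deletes exactly one point from the remaining set, as the
  -- constructor `matched` demands.
  unmatched-∷ : ∀ {b : Fin n} {ms xs} → Unique xs → b ∈ unmatched ms xs →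
    unmatched ms xs ↭ b ∷ unmatched (b ∷ ms) xs
  unmatched-∷ {b} {ms} {xs} xs! b∈ =
    Unique∧set⇒↭ (Unique.filter⁺ (∉? ms) xs!)
      (All.tabulate (unmatched-≢ xs) ∷ Unique.filter⁺ (∉? (b ∷ ms)) xs!) to from
    where
    to : ∀ {z} → z ∈ unmatched ms xs → z ∈ b ∷ unmatched (b ∷ ms) xs
    to {z} z∈ with z Fin.≟ b | ∈-filter⁻ (∉? ms) {xs = xs} z∈
    ... | yes z≡b | _ = here z≡b
    ... | no z≢b | z∈xs , z∉ = there (∈-filter⁺ (∉? (b ∷ ms)) z∈xs λ where
      (here z≡b) → z≢b z≡b
      (there z∈) → z∉ z∈)
    from : ∀ {z} → z ∈ b ∷ unmatched (b ∷ ms) xs → z ∈ unmatched ms xs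
    from (here refl) = b∈
    from (there z∈) with z∈xs , z∉ ← ∈-filter⁻ (∉? (b ∷ ms)) {xs = xs} z∈ =
      ∈-filter⁺ (∉? ms) z∈xs (z∉ ∘ there)

  -- Letters are points with their value as column. Since `r` decreases in reading order, the letter
  -- being read has the maximal row among the unmatched ones, and comparing it with the largest of
  -- the others finds the maximal column.
  columns-isInsertion : ∀ {r : Fin n → ℕ} ms {xs} → AllPairs (λ x y → r y < r x) xs →
    IsInsertion r number (unmatched ms xs) (columns ms xs)
  columns-isInsertion ms [] = []
  columns-isInsertion {r} ms {a ∷ xs} (ra ∷ rxs) with a ∈? ms
  ... | yes _ = columns-isInsertion ms rxs
  ... | no _ with largest (unmatched ms xs) in eq
  ...   | nothing = fixed ↭-refl (All.filter⁺ (∉? ms) ra)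
            (subst (All _) (sym (largest-nothing eq)) []) (columns-isInsertion ms rxs)
  ...   | just b with b∈ , ≤b ← largest-just eq | a Fin.<? b
  -- The other unmatched letters are at most `b`, hence at most `a`; their strictly smaller `r`
  -- excludes equality with `a`.
  ...     | no a≮b = fixed ↭-refl R
              (All.tabulate λ z∈ → s≤s (ℕ.≤∧≢⇒< (ℕ.≤-trans (≤b z∈) (ℕ.≮⇒≥ a≮b))
                λ z≡a → <-irrefl (cong r (Fin.toℕ-injective z≡a)) (All.lookup R z∈)))
              (columns-isInsertion ms rxs)
    where R = All.filter⁺ (∉? ms) ra
  ...     | yes a<b = matched (prep a e) (All-resp-↭ e (All.filter⁺ (∉? ms) ra))
              (s≤s a<b ∷ All.tabulate λ z∈ →
                s≤s (ℕ.≤∧≢⇒< (≤b (∈-resp-↭ (↭-sym e) (there z∈)))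
                  λ z≡b → unmatched-≢ xs z∈ (sym (Fin.toℕ-injective z≡b))))
              (columns-isInsertion (b ∷ ms) rxs)
    where
    e : unmatched ms xs ↭ b ∷ unmatched (b ∷ ms) xs
    e = unmatched-∷ (AllPairs.map (λ { ry<rx refl → <-irrefl refl ry<rx }) rxs) b∈

-- Points of a rectangle

-- Both axes have this form, one with the inverse of `σ`, the other with the identity; exchanging
-- the two transposes the diagram.
coordinate : Permutation′ n → Fin n → ℕ
coordinate ρ a = number (ρ ⟨$⟩ʳ a)

coordinate-injective : (ρ : Permutation′ n) → Injective (coordinate ρ)
coordinate-injective ρ {a} {b} e =
  trans (sym (inverseˡ ρ)) (trans (cong (ρ ⟨$⟩ˡ_) (number-injective e)) (inverseˡ ρ))

coordinate≤n : (ρ : Permutation′ n) (a : Fin n) → coordinate ρ a ≤ n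
coordinate≤n ρ a = toℕ<n (ρ ⟨$⟩ʳ a)

coordinate-preimage : (ρ : Permutation′ n) (m<n : m < n) →
  coordinate ρ (ρ ⟨$⟩ˡ fromℕ< m<n) ≡ suc m
coordinate-preimage ρ m<n = cong suc (trans (cong toℕ (inverseʳ ρ)) (toℕ-fromℕ< m<n))

module _ (r c : Fin n → ℕ) where

  Region : ℕ → ℕ → Fin n → Set
  Region i j a = r a ≤ i × c a ≤ j

  region? : ∀ i j a → Dec (Region i j a)
  region? i j a = (r a ℕ.≤? i) ×-dec (c a ℕ.≤? j)

  region : ℕ → ℕ → List (Fin n)
  region i j = filter (region? i j) (allFin n)

  region-unique : ∀ i j → Unique (region i j)
  region-unique i j = Unique.filter⁺ (region? i j) (Unique.allFin⁺ n)

  ∈-region⁺ : Region i j a → a ∈ region i j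
  ∈-region⁺ {i} {j} = ∈-filter⁺ (region? i j) (∈-allFin _)

  ∈-region⁻ : a ∈ region i j → Region i j a
  ∈-region⁻ {i = i} {j} = proj₂ ∘ ∈-filter⁻ (region? i j) {xs = allFin n}

  region-full : (∀ a → Region i j a) → region i j ↭ allFin n
  region-full {i} {j} all = ↭-reflexive (filter-all (region? i j) (All.universal all _))

  region-row-skip : (∀ {a} → r a ≡ suc i → ¬ c a ≤ j) → region (suc i) j ↭ region i j
  region-row-skip {i} {j} none = Unique∧set⇒↭ (region-unique _ _) (region-unique _ _)
      (∈-region⁺ ∘ shrink ∘ ∈-region⁻)
      (λ z∈ → let r≤ , c≤ = ∈-region⁻ z∈ in ∈-region⁺ (ℕ.m≤n⇒m≤1+n r≤ , c≤))
    where
    shrink : Region (suc i) j a → Region i j a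
    shrink (r≤ , c≤) = ≤suc∧≢⇒≤ r≤ (λ r≡ → none r≡ c≤) , c≤

  region-row-add : Injective r → r a ≡ suc i → c a ≤ j → region (suc i) j ↭ a ∷ region i j
  region-row-add {a} {i} {j} inj ra≡ ca≤ = Unique∧set⇒↭ (region-unique _ _)
      (All.tabulate fresh ∷ region-unique _ _) (split ∘ ∈-region⁻) λ where
        (here refl) → ∈-region⁺ (ℕ.≤-reflexive ra≡ , ca≤)
        (there z∈)  → let r≤ , c≤ = ∈-region⁻ z∈ in ∈-region⁺ (ℕ.m≤n⇒m≤1+n r≤ , c≤)
    where
    fresh : ∀ {z} → z ∈ region i j → a ≢ z
    fresh z∈ refl = ℕ.<⇒≱ (ℕ.≤-reflexive (sym ra≡)) (proj₁ (∈-region⁻ z∈))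
    split : ∀ {z} → Region (suc i) j z → z ∈ a ∷ region i j
    split {z} (r≤ , c≤) with z Fin.≟ a
    ... | yes refl = here refl
    ... | no z≢a   = there (∈-region⁺
      (≤suc∧≢⇒≤ r≤ (λ r≡ → z≢a (inj (trans r≡ (sym ra≡)))) , c≤))

-- Through this symmetry the statements about a new row also serve for a new column.
region-flip : (r c : Fin n → ℕ) → ∀ i j → region r c i j ↭ region c r j i
region-flip r c i j = Unique∧set⇒↭ (region-unique r c i j) (region-unique c r j i)
  (∈-region⁺ c r ∘ Product.swap ∘ ∈-region⁻ r c) (∈-region⁺ r c ∘ Product.swap ∘ ∈-region⁻ c r)

region-column-skip : (r c : Fin n → ℕ) → (∀ {a} → c a ≡ suc j → ¬ r a ≤ i) →
  region r c i (suc j) ↭ region r c i j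
region-column-skip r c none = ↭-trans (region-flip r c _ _)
  (↭-trans (region-row-skip c r none) (region-flip c r _ _))

region-column-add : (r c : Fin n → ℕ) → Injective c → c a ≡ suc j → r a ≤ i →
  region r c i (suc j) ↭ a ∷ region r c i j
region-column-add r c inj ca≡ ra≤ = ↭-trans (region-flip r c _ _)
  (↭-trans (region-row-add c r inj ca≡ ra≤) (prep _ (region-flip c r _ _)))

-- Growth diagrams

local-two : ∀ α → x ≢ t → y ≢ t → local t x y α ≡ two ∷ t
local-two {x} {t} {y} α x≢t y≢t with x ≟ t | y ≟ t
... | no _    | no _    = refl
... | yes x≡t | _       = contradiction x≡t x≢t
... | no _    | yes y≡t = contradiction y≡t y≢t

local-one : x ≡ t → y ≡ t → local t x y true ≡ one ∷ t
local-one {x} {t} {y} x≡t y≡t with x ≟ t | y ≟ t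
... | yes _  | yes _  = refl
... | no x≢t | _      = contradiction x≡t x≢t
... | yes _  | no y≢t = contradiction y≡t y≢t

module _ (ρ κ : Permutation′ n) where

  private
    row column : Fin n → ℕ
    row    = coordinate ρ
    column = coordinate κ

    rect : ℕ → ℕ → List (Fin n)
    rect = region row column

    row-injective : Injective row
    row-injective = coordinate-injective ρ

    column-injective : Injective column
    column-injective = coordinate-injective κ

    Insertion-at : ℕ → ℕ → Tableau (Fin n) → Set
    Insertion-at i j = IsInsertion row column (rect i j)

  -- With `Reflects`, matching on the existence of the point also fixes the Boolean passed to
  -- `local`.
  Marks : (ℕ → ℕ → Bool) → Set
  Marks α = ∀ i j → Reflects (∃ λ a → row a ≡ i × column a ≡ j) (α i j)

  shape-≡ : ∀ {i j i′ j′} → rect i j ↭ rect i′ j′ →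
    Insertion-at i j T → Insertion-at i′ j′ T′ → proj₁ T ≡ proj₁ T′
  shape-≡ e I I′ = cong proj₁ (IsInsertion-unique e I I′)

  -- Boxes count points, so one more point changes the size of the shape.
  shape-≢ : ∀ {i j i′ j′} → rect i′ j′ ↭ a ∷ rect i j →
    Insertion-at i j T → Insertion-at i′ j′ T′ → proj₁ T′ ≢ proj₁ T
  shape-≢ e I I′ T′≡T = ℕ.1+n≢n (trans (sym (trans (IsInsertion-size I′) (↭-length e)))
    (trans (cong size T′≡T) (IsInsertion-size I)))

  in-rect : ∀ {P : Fin n → Set} → (∀ {a} → row a ≤ i → column a ≤ j → P a) →
    All P (rect i j)
  in-rect h = All.tabulate λ z∈ → let r≤ , c≤ = ∈-region⁻ row column z∈ in h r≤ c≤

  local-isInsertion : ∀ {α t x y} →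
    Reflects (∃ λ a → row a ≡ suc i × column a ≡ suc j) α →
    Insertion-at i j t → Insertion-at i (suc j) x → Insertion-at (suc i) j y →
    ∃ λ z → Insertion-at (suc i) (suc j) z × proj₁ z ≡ local (proj₁ t) (proj₁ x) (proj₁ y) α
  -- A marked corner is the only point of its row and of its column, so the other three rectangles
  -- contain the same points.
  local-isInsertion {i} {j} (ofʸ (a , ra≡ , ca≡)) It Ix Iy =
      _ , fixed
            (↭-trans (region-row-add row column row-injective ra≡ (ℕ.≤-reflexive ca≡))
              (prep a x↭t))
            (in-rect λ r≤ _ → ≤∧≡suc⇒< r≤ ra≡)
            (in-rect λ _ c≤ → ≤∧≡suc⇒< c≤ ca≡) It
    , sym (local-one (shape-≡ x↭t Ix It) (shape-≡ y↭t Iy It))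
    where
    x↭t : rect i (suc j) ↭ rect i j
    x↭t = region-column-skip row column λ cb≡ rb≤ → ℕ.<⇒≱ (ℕ.≤-reflexive (sym ra≡))
      (subst (λ b → row b ≤ i) (column-injective (trans cb≡ (sym ca≡))) rb≤)
    y↭t : rect (suc i) j ↭ rect i j
    y↭t = region-row-skip row column λ rb≡ cb≤ → ℕ.<⇒≱ (ℕ.≤-reflexive (sym ca≡))
      (subst (λ b → column b ≤ j) (row-injective (trans rb≡ (sym ra≡))) cb≤)
  local-isInsertion {i} {j} {t = t} {x} {y} (ofⁿ none) It Ix Iy
    with any? (λ a → (row a ℕ.≟ suc i) ×-dec (column a ℕ.≤? j))
       | any? (λ a → (column a ℕ.≟ suc j) ×-dec (row a ℕ.≤? i))
  -- The new row is empty, so `y` agrees with `t` and the corner with `x`, whether or not the new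
  -- column is empty.
  ... | no ¬row | _ = x , IsInsertion-resp-↭ (↭-sym z↭x) Ix
      , local-unmarked _ _ _ (shape-≡ y↭t Iy It)
    where
    y↭t : rect (suc i) j ↭ rect i j
    y↭t = region-row-skip row column λ r≡ c≤ → ¬row (_ , r≡ , c≤)
    z↭x : rect (suc i) (suc j) ↭ rect i (suc j)
    z↭x = region-row-skip row column λ r≡ c≤ →
      ¬row (_ , r≡ , ≤suc∧≢⇒≤ c≤ (λ c≡ → none (_ , r≡ , c≡)))
  ... | yes _ | no ¬column = y , IsInsertion-resp-↭ (↭-sym z↭y) Iy
      , trans (local-unmarked _ _ _ (shape-≡ x↭t Ix It))
          (local-sym (proj₁ t) (proj₁ y) (proj₁ x) false)
    where
    x↭t : rect i (suc j) ↭ rect i j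
    x↭t = region-column-skip row column λ c≡ r≤ → ¬column (_ , c≡ , r≤)
    z↭y : rect (suc i) (suc j) ↭ rect (suc i) j
    z↭y = region-column-skip row column λ c≡ r≤ →
      ¬column (_ , c≡ , ≤suc∧≢⇒≤ r≤ (λ r≡ → none (_ , r≡ , c≡)))
  -- Here `p` lies in the new row and `q` in the new column, both off the corner. They form the
  -- first column, and removing them leaves the points of the rectangle of `t`.
  ... | yes (p , rp≡ , cp≤) | yes (q , cq≡ , rq≤) =
    _ , matched
          (↭-trans (region-row-add row column row-injective rp≡ (ℕ.m≤n⇒m≤1+n cp≤)) (prep p x↭))
          (≤∧≡suc⇒< rq≤ rp≡ ∷ in-rect λ r≤ _ → ≤∧≡suc⇒< r≤ rp≡)
          (≤∧≡suc⇒< cp≤ cq≡ ∷ in-rect λ _ c≤ → ≤∧≡suc⇒< c≤ cq≡) It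
      , sym (local-two false (shape-≢ x↭ It Ix)
          (shape-≢ (region-row-add row column row-injective rp≡ cp≤) It Iy))
    where
    x↭ : rect i (suc j) ↭ q ∷ rect i j
    x↭ = region-column-add row column column-injective cq≡ rq≤

  rect-zeroˡ : ∀ j → rect 0 j ≡ []
  rect-zeroˡ j = filter-none (region? row column 0 j) (All.universal (λ { _ (() , _) }) (allFin n))

  rect-zeroʳ : ∀ i → rect i 0 ≡ []
  rect-zeroʳ i = filter-none (region? row column i 0) (All.universal (λ { _ (_ , ()) }) (allFin n))

  grid-isInsertion : ∀ {α} → Marks α → ∀ i j → ∃ λ T → Insertion-at i j T × proj₁ T ≡ grid α i j
  grid-isInsertion marks zero j rewrite rect-zeroˡ j = _ , [] , refl
  grid-isInsertion marks (suc i) zero rewrite rect-zeroʳ (suc i) = _ , [] , refl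
  grid-isInsertion {α} marks (suc i) (suc j)
    with t , It , t≡ ← grid-isInsertion marks i j
       | x , Ix , x≡ ← grid-isInsertion marks i (suc j)
       | y , Iy , y≡ ← grid-isInsertion marks (suc i) j
    with z , Iz , z≡ ← local-isInsertion (marks (suc i) (suc j)) It Ix Iy
    = z , Iz , trans z≡ (local-cong t≡ x≡ y≡)
    where
    local-cong : ∀ {t t′ x x′ y y′ b} → t ≡ t′ → x ≡ x′ → y ≡ y′ →
      local t x y b ≡ local t′ x′ y′ b
    local-cong refl refl refl = refl

  -- All rows are at most `n`, so passing to `suc m` adds exactly one point, of maximal column, and
  -- `insert-maximum` applies. The pointwise hypothesis on `u` accommodates the upper boundary,
  -- which is a right boundary up to `grid-flip`.
  convert-isInsertion : ∀ {α} → Marks α → ∀ {u} → (∀ k → u k ≡ grid α n k) →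
    (s : Saturated u m) → m ≤ n →
    ∃ λ T → Insertion-at n m T × (u m , convert s) ≡ mapTableau (mapColumn column) T
  convert-isInsertion marks _ (start u₀≡[]) _ rewrite rect-zeroʳ n = _ , [] , start-≡ u₀≡[]
    where
    start-≡ : ∀ {v} (e : v ≡ []) →
      _≡_ {A = Tableau ℕ} (v , subst (Numbering ℕ) (sym e) []) ([] , [])
    start-≡ refl = refl
  convert-isInsertion {suc m} marks u≡grid (s ▷ u⋖v) m<n
    with T , I , T≡ ← convert-isInsertion marks u≡grid s (ℕ.<⇒≤ m<n)
    with T′ , I′ , S ← insert-maximum {a = κ ⟨$⟩ˡ fromℕ< m<n} row-injective
           (in-rect λ _ c≤ → ≤∧≡suc⇒< c≤ (coordinate-preimage κ m<n)) I
    -- The growth diagram gives the shape of `u (suc m)`; by uniqueness it is the shape of `T′`.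
    with T″ , I″ , T″≡ ← grid-isInsertion marks n (suc m)
    = T′ , I‴
    , subst (λ k → (_ , extend k u⋖v (convert s)) ≡ mapTableau (mapColumn column) T′)
        (coordinate-preimage κ m<n)
        (Step⇒extend column S u⋖v T≡
          (trans (u≡grid (suc m)) (trans (sym T″≡) (shape-≡ ↭-refl I″ I‴))))
    where
    I‴ : Insertion-at n (suc m) T′
    I‴ = IsInsertion-resp-↭ (↭-sym (region-column-add row column column-injective
      (coordinate-preimage κ m<n) (coordinate≤n ρ _))) I′

  convert-full : ∀ {α} → Marks α → ∀ {u} → (∀ k → u k ≡ grid α n k) → (s : Saturated u n) →
    IsInsertion row column (allFin n) T → (u n , convert s) ≡ mapTableau (mapColumn column) T
  convert-full marks u≡grid s I with T , I′ , T≡ ← convert-isInsertion marks u≡grid s ℕ.≤-refl =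
    trans T≡ (cong (mapTableau (mapColumn column)) (IsInsertion-unique
      (region-full row column λ a → coordinate≤n ρ a , coordinate≤n κ a) I′ I))

-- Points are represented by their values: the point (i , σ(i)) is σ(i) : Fin n.

AllPairs-reverse : ∀ {R : A → A → Set} {xs} → AllPairs R xs → AllPairs (flip R) (reverse xs)
AllPairs-reverse [] = []
AllPairs-reverse {xs = x ∷ xs} (Rx ∷ Rxs) rewrite unfold-reverse x xs =
  AllPairs.++⁺ (AllPairs-reverse Rxs) ([] ∷ [])
    (All.map (_∷ []) (All-resp-↭ (↭-sym (↭-reverse xs)) Rx))

module _ (σ : Permutation′ n) where

  private
    position : Fin n → ℕ
    position = coordinate (Permutation.flip σ)

  insertionTableau-isInsertion :
    IsInsertion position number (allFin n) (insertionTableau σ)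
  insertionTableau-isInsertion = IsInsertion-resp-↭ word↭ (columns-isInsertion [] decreasing)
    where
    word : List (Fin n)
    word = reverse (map (σ ⟨$⟩ʳ_) (allFin n))
    -- The letter σ(i) has position i, so positions increase along the word before it is reversed.
    decreasing : AllPairs (λ x y → position y < position x) word
    decreasing = AllPairs-reverse (AllPairs.map⁺ (AllPairs.tabulate⁺-< λ i<j →
      s≤s (subst₂ Fin._<_ (sym (inverseˡ σ)) (sym (inverseˡ σ)) i<j)))
    word↭ : unmatched [] word ↭ allFin n
    word↭ rewrite filter-all (∉? []) (All.universal (λ _ ()) word) =
      Unique∧set⇒↭ (AllPairs.map (λ { ry<rx refl → <-irrefl refl ry<rx }) decreasing)
        (Unique.allFin⁺ n) (λ _ → ∈-allFin _)
        λ {z} _ → ∈-resp-↭ (↭-sym (↭-reverse (map (σ ⟨$⟩ʳ_) (allFin n))))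
          (subst (_∈ _) (inverseʳ σ) (∈-map⁺ (σ ⟨$⟩ʳ_) (∈-allFin (σ ⟨$⟩ˡ z))))

  -- `marked?` searches among positions and `Marks` among values; `σ` and its inverse translate the
  -- witnesses.
  mark-marks : Marks (Permutation.flip σ) Permutation.id (mark σ)
  mark-marks i j = proof (map′
    (λ (k , k≡ , σk≡) → σ ⟨$⟩ʳ k , trans (cong number (inverseˡ σ)) k≡ , σk≡)
    (λ (a , σ⁻¹a≡ , a≡) → σ ⟨$⟩ˡ a , σ⁻¹a≡ , trans (cong number (inverseʳ σ)) a≡)
    (marked? σ i j))

  mark-marks-flip : Marks Permutation.id (Permutation.flip σ) (flip (mark σ))
  mark-marks-flip i j = proof (map′
    (λ (k , k≡ , σk≡) → σ ⟨$⟩ʳ k , σk≡ , trans (cong number (inverseˡ σ)) k≡)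
    (λ (a , a≡ , σ⁻¹a≡) → σ ⟨$⟩ˡ a , σ⁻¹a≡ , trans (cong number (inverseʳ σ)) a≡)
    (marked? σ j i))

mapTableau-swapColumn : (f : A → B) (T : Tableau A) →
  mapTableau (mapColumn f) (mapTableau swapColumn T) ≡ mapTableau (mapColumn f ∘ swapColumn) T
mapTableau-swapColumn f (u , N) = cong (u ,_) (All.map-∘ N)

theorem3p2 : (n : ℕ) → 1 ≤ n → (σ : Permutation′ n) →
    (P̂ σ ≡ P σ) × (Q̂ σ ≡ Q σ)
theorem3p2 n _ σ =
    convert-full (Permutation.flip σ) Permutation.id (mark-marks σ) (λ _ → refl) (rightChain σ) I
  , trans
      -- The upper boundary is the right boundary of the transposed diagram, where the insertion
      -- tableau has its columns swapped and each entry is labelled by its position.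
      (convert-full Permutation.id (Permutation.flip σ) (mark-marks-flip σ)
        (λ k → sym (grid-flip (mark σ) k n)) (upperChain σ) (IsInsertion-transpose I))
      (mapTableau-swapColumn _ (insertionTableau σ))
  where I = insertionTableau-isInsertion σ
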